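{- There exists a locally finite poset $Q$ with a minimum element such that: (a) $Q$ has the Möbius uncertainty property: whenever $f,g:Q\to\mathbb{C}$ are functions, neither identically zero, with $g(z)=\sum_{x\leqslant z} f(x)$ for all $z\in Q$, at least one of $\{x: f(x)\neq0\}$ and $\{x: g(x)\neq 0\}$ is infinite; and (b) $Q$ does not have property $\mathcal{H}_3$: there is a three-element subset $S\subset Q$ such that for every $z\in S$ there are only finitely many $x\in Q$ with $x\geqslant z$ and $x\not\geqslant y$ for all $y\in S\setminus\{z\}$. Consequently, the Möbius uncertainty property does not imply property $\mathcal{H}_k$ for every $k\in\mathbb{N}$.
   Context: A poset is locally finite if every interval $\{z: x\leqslant z\leqslant y\}$ is finite. For $k\in\mathbb{N}$, a poset $P$ has property $\mathcal{H}_k$ if for every subset $S\subset P$ with $|S|=k$ there exists $z\in S$ such that infinitely many $x\in P$ satisfy $x\geqslant z$ and $x\not\geqslant y$ for all $y\in S\setminus\{z\}$. -}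

module Defs where

open import Data.List.Base using (List; length; map; foldr)
open import Data.Nat.Base as ℕ using (ℕ)
import Data.Nat.Properties as ℕₚ
open import Data.Product.Base using (Σ-syntax; ∃-syntax; _×_; _,_; proj₁; proj₂)
open import Data.Rational.Base using (ℚ; 0ℚ; ½; ∣_∣; _<_)
  renaming (_+_ to _+ℚ_; _-_ to _-ℚ_; -_ to -ℚ_; _*_ to _*ℚ_)
import Data.Rational.Properties as ℚₚ
open import Data.Rational.Solver using (module +-*-Solver)
open import Data.Sum.Base using (_⊎_)
open import Function.Bundles using (Func; _⟶ₛ_; _⇔_; mk⇔; Equivalence)
open import Level using (0ℓ)
open import Relation.Binary.Bundles using (Setoid; Poset)
open import Relation.Binary.Definitions using (Minimum)
open import Relation.Binary.PropositionalEquality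
  using (_≡_; refl; sym; trans; cong; subst)
open import Relation.Nullary.Negation using (¬_)
open import Relation.Unary using (Pred)
import Data.List.Membership.Setoid as Membership
import Data.List.Relation.Unary.Unique.Setoid as UniqueSetoid

------------------------------------------------------------------------
-- ℝ as Cauchy sequences of rationals modulo null sequences, and ℂ = ℝ × ℝ.
-- Only the additive structure and equality of ℂ are developed: summing
-- complex values and comparing them with 0 uses nothing else.

Cauchy : (ℕ → ℚ) → Set
Cauchy x = ∀ ε → 0ℚ < ε →
  ∃[ N ] (∀ m n → N ℕ.≤ m → N ℕ.≤ n → ∣ x m -ℚ x n ∣ < ε)

record ℝ : Set where
  constructor mkℝ
  field
    seq    : ℕ → ℚ
    cauchy : Cauchy seq
open ℝ public

infix 4 _≈ℝ_
_≈ℝ_ : ℝ → ℝ → Set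
x ≈ℝ y = ∀ ε → 0ℚ < ε →
  ∃[ N ] (∀ n → N ℕ.≤ n → ∣ seq x n -ℚ seq y n ∣ < ε)

private
  0<½ε : ∀ {ε} → 0ℚ < ε → 0ℚ < ½ *ℚ ε
  0<½ε {ε} 0<ε = subst (_< ½ *ℚ ε) (ℚₚ.*-zeroʳ ½) (ℚₚ.*-monoʳ-<-pos ½ 0<ε)

  ½ε+½ε : ∀ ε → ½ *ℚ ε +ℚ ½ *ℚ ε ≡ ε
  ½ε+½ε ε = trans (sym (ℚₚ.*-distribʳ-+ ε ½ ½)) (ℚₚ.*-identityˡ ε)

  ∣a+b∣<ε : ∀ {a b c ε} → c ≡ a +ℚ b →
            ∣ a ∣ < ½ *ℚ ε → ∣ b ∣ < ½ *ℚ ε → ∣ c ∣ < ε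
  ∣a+b∣<ε {a} {b} {c} {ε} refl p q = subst (∣ a +ℚ b ∣ <_) (½ε+½ε ε)
    (ℚₚ.≤-<-trans (ℚₚ.∣p+q∣≤∣p∣+∣q∣ a b) (ℚₚ.+-mono-< p q))

  ∣a-a∣<ε : ∀ a {ε} → 0ℚ < ε → ∣ a -ℚ a ∣ < ε
  ∣a-a∣<ε a {ε} = subst (λ d → ∣ d ∣ < ε) (sym (ℚₚ.+-inverseʳ a))

  ∣a-b∣≡∣b-a∣ : ∀ a b → ∣ a -ℚ b ∣ ≡ ∣ b -ℚ a ∣
  ∣a-b∣≡∣b-a∣ a b = trans
    (cong ∣_∣ (solve 2 (λ a b → a :- b := :- (b :- a)) refl a b))
    (ℚₚ.∣-p∣≡∣p∣ (b -ℚ a))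
    where open +-*-Solver

  telescope : ∀ a b c → a -ℚ c ≡ (a -ℚ b) +ℚ (b -ℚ c)
  telescope = solve 3 (λ a b c → a :- c := (a :- b) :+ (b :- c)) refl
    where open +-*-Solver

  interchange : ∀ a b c d → (a +ℚ b) -ℚ (c +ℚ d) ≡ (a -ℚ c) +ℚ (b -ℚ d)
  interchange = solve 4 (λ a b c d →
    (a :+ b) :- (c :+ d) := (a :- c) :+ (b :- d)) refl
    where open +-*-Solver

≈ℝ-refl : ∀ {x} → x ≈ℝ x
≈ℝ-refl {x} ε 0<ε = 0 , λ n _ → ∣a-a∣<ε (seq x n) 0<ε

≈ℝ-sym : ∀ {x y} → x ≈ℝ y → y ≈ℝ x
≈ℝ-sym {x} {y} x≈y ε 0<ε = let N , h = x≈y ε 0<ε in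
  N , λ n N≤n → subst (_< ε) (∣a-b∣≡∣b-a∣ (seq x n) (seq y n)) (h n N≤n)

≈ℝ-trans : ∀ {x y z} → x ≈ℝ y → y ≈ℝ z → x ≈ℝ z
≈ℝ-trans {x} {y} {z} x≈y y≈z ε 0<ε =
  let M , h = x≈y (½ *ℚ ε) (0<½ε 0<ε)
      N , k = y≈z (½ *ℚ ε) (0<½ε 0<ε)
  in M ℕ.⊔ N , λ n le → ∣a+b∣<ε (telescope (seq x n) (seq y n) (seq z n))
       (h n (ℕₚ.≤-trans (ℕₚ.m≤m⊔n M N) le))
       (k n (ℕₚ.≤-trans (ℕₚ.m≤n⊔m M N) le))

0ℝ : ℝ
0ℝ = mkℝ (λ _ → 0ℚ) (λ ε 0<ε → 0 , λ _ _ _ _ → ∣a-a∣<ε 0ℚ 0<ε)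

infixl 6 _+ℝ_
_+ℝ_ : ℝ → ℝ → ℝ
x +ℝ y = mkℝ (λ n → seq x n +ℚ seq y n) λ ε 0<ε →
  let M , h = cauchy x (½ *ℚ ε) (0<½ε 0<ε)
      N , k = cauchy y (½ *ℚ ε) (0<½ε 0<ε)
      M≤ = ℕₚ.m≤m⊔n M N
      N≤ = ℕₚ.m≤n⊔m M N
  in M ℕ.⊔ N , λ m n p q →
       ∣a+b∣<ε (interchange (seq x m) (seq y m) (seq x n) (seq y n))
         (h m n (ℕₚ.≤-trans M≤ p) (ℕₚ.≤-trans M≤ q))
         (k m n (ℕₚ.≤-trans N≤ p) (ℕₚ.≤-trans N≤ q))

record ℂ : Set where
  constructor _+i_
  field
    re im : ℝ
open ℂ public

infix 4 _≈ℂ_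
_≈ℂ_ : ℂ → ℂ → Set
w ≈ℂ z = (re w ≈ℝ re z) × (im w ≈ℝ im z)

0ℂ : ℂ
0ℂ = 0ℝ +i 0ℝ

infixl 6 _+ℂ_
_+ℂ_ : ℂ → ℂ → ℂ
w +ℂ z = (re w +ℝ re z) +i (im w +ℝ im z)

ℂ-setoid : Setoid 0ℓ 0ℓ
ℂ-setoid = record
  { Carrier       = ℂ
  ; _≈_           = _≈ℂ_
  ; isEquivalence = record
    { refl  = λ {w} → ≈ℝ-refl {re w} , ≈ℝ-refl {im w}
    ; sym   = λ {w} {z} (p , q) →
        ≈ℝ-sym {re w} {re z} p , ≈ℝ-sym {im w} {im z} q
    ; trans = λ {u} {w} {z} (p , q) (p′ , q′) →
        ≈ℝ-trans {re u} {re w} {re z} p p′ , ≈ℝ-trans {im u} {im w} {im z} q q′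
    }
  }

------------------------------------------------------------------------
-- Finite and infinite subsets of a set.

module _ (X : Setoid 0ℓ 0ℓ) where
  open Setoid X
  open Membership X using (_∈_)
  open UniqueSetoid X using (Unique)

  -- A is finite when a list without repetitions contains exactly its elements.
  record Finite (A : Pred Carrier 0ℓ) : Set where
    field
      elements : List Carrier
      unique   : Unique elements
      exact    : ∀ x → x ∈ elements ⇔ A x

  Infinite : Pred Carrier 0ℓ → Set
  Infinite A = ¬ Finite A

  record SubsetOfSize (k : ℕ) : Set where
    field
      elements : List Carrier
      unique   : Unique elements
      size     : length elements ≡ k

  infix 4 _∈ˢ_
  _∈ˢ_ : ∀ {k} → Carrier → SubsetOfSize k → Set
  x ∈ˢ S = x ∈ SubsetOfSize.elements S

------------------------------------------------------------------------
-- Posets.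

module _ (P : Poset 0ℓ 0ℓ 0ℓ) where
  open Poset P

  LocallyFinite : Set
  LocallyFinite = ∀ x y → Finite Eq.setoid (λ z → x ≤ z × z ≤ y)

  -- x lies above z but above no other element of S.
  AboveOnly : ∀ {k} → SubsetOfSize Eq.setoid k → Carrier → Pred Carrier 0ℓ
  AboveOnly S z x = z ≤ x × (∀ y → _∈ˢ_ Eq.setoid y S → ¬ (y ≈ z) → ¬ (y ≤ x))

  PropertyH : ℕ → Set
  PropertyH k = (S : SubsetOfSize Eq.setoid k) →
    ∃[ z ] (_∈ˢ_ Eq.setoid z S × Infinite Eq.setoid (AboveOnly S z))

  -- A witness against PropertyH k, with the finiteness asserted positively.
  RefutingSubset : ℕ → Set
  RefutingSubset k = Σ[ S ∈ SubsetOfSize Eq.setoid k ]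
    (∀ z → _∈ˢ_ Eq.setoid z S → Finite Eq.setoid (AboveOnly S z))

record LocallyFinitePosetWithMin : Set₁ where
  field
    poset         : Poset 0ℓ 0ℓ 0ℓ
    locallyFinite : LocallyFinite poset
    ⊥             : Poset.Carrier poset
    minimum       : Minimum (Poset._≤_ poset) ⊥

  open Poset poset public

  downSet : ∀ z → Finite Eq.setoid (_≤ z)
  downSet z = record
    { elements = elements
    ; unique   = unique
    ; exact    = λ x → mk⇔ (λ i → proj₂ (Equivalence.to (exact x) i))
                           (λ x≤z → Equivalence.from (exact x) (minimum x , x≤z))
    }
    where open Finite (locallyFinite ⊥ z)

  -- sumBelow f z = Σ_{x ≤ z} f(x)
  sumBelow : (Carrier → ℂ) → Carrier → ℂ
  sumBelow f z = foldr _+ℂ_ 0ℂ (map f (Finite.elements (downSet z)))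

open LocallyFinitePosetWithMin public using (poset)

module _ (Q : LocallyFinitePosetWithMin) where
  open LocallyFinitePosetWithMin Q

  support : Eq.setoid ⟶ₛ ℂ-setoid → Pred Carrier 0ℓ
  support f x = ¬ (Func.to f x ≈ℂ 0ℂ)

  IdenticallyZero : Eq.setoid ⟶ₛ ℂ-setoid → Set
  IdenticallyZero f = ∀ x → Func.to f x ≈ℂ 0ℂ

  -- The double negation makes "at least one is infinite" the classical
  -- disjunction; a constructive one would have to decide which set it is.
  MöbiusUncertainty : Set
  MöbiusUncertainty = (f g : Eq.setoid ⟶ₛ ℂ-setoid) →
    ¬ IdenticallyZero f → ¬ IdenticallyZero g →
    (∀ z → Func.to g z ≈ℂ sumBelow (Func.to f) z) →
    ¬ ¬ (Infinite Eq.setoid (support f) ⊎ Infinite Eq.setoid (support g))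

{-# OPTIONS --safe #-}

-- The poset Q consists of a minimum, three atoms, for each pair of atoms
-- infinitely many elements lying above exactly these two atoms, and, freely
-- iterated, infinitely many children of every element that is not an atom.
-- For f and g of finite support, a fresh child of t (one where f and g vanish)
-- gives g(t) = 0, because its strict down-set is the down-set of t. A fresh
-- element above exactly two atoms a and b gives f(a) + f(b) = 0; the three such
-- equations force f to vanish at the atoms, as 2 is invertible, and then f
-- vanishes everywhere. But an element above an atom is that atom itself or
-- lies above a second one, so the three atoms refute the property H₃.
module Submission where

open import Defs
open import Algebra.Bundles using (CommutativeMonoid)
import Algebra.Properties.CommutativeSemigroup as CommutativeSemigroupProperties
open import Data.Empty using (⊥-elim)
open import Data.Fin.Base using (Fin; zero; suc; punchIn)
import Data.Fin.Properties as Fin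
open import Data.List.Base
  using (List; []; _∷_; _++_; filter; foldr; map; allFin)
open import Data.List.Extrema.Nat using (max; xs≤max)
open import Data.List.Membership.Propositional using (_∈_; _∉_)
open import Data.List.Membership.Propositional.Properties
  using (∈-filter⁺; ∈-filter⁻; ∈-map⁺; ∈-map⁻; ∈-++⁺ˡ; ∈-++⁺ʳ; ∈-allFin)
open import Data.List.Properties using (filter-all)
open import Data.List.Relation.Unary.All as All using (All; []; _∷_)
open import Data.List.Relation.Unary.All.Properties using (¬Any⇒All¬)
open import Data.List.Relation.Unary.AllPairs using ([]; _∷_)
open import Data.List.Relation.Unary.Any using (here; there)
open import Data.List.Relation.Unary.Unique.Propositional using (Unique)
import Data.List.Relation.Unary.Unique.Propositional.Properties as Unique
open import Data.Nat.Base as ℕ using (ℕ; _≤_; z≤n; s≤s)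
import Data.Nat.Properties as ℕ
open import Data.Product.Base using (Σ-syntax; ∃-syntax; _×_; _,_; proj₁; proj₂)
open import Data.Rational.Base as ℚ using (0ℚ; ½)
import Data.Rational.Properties as ℚ
open import Data.Rational.Solver using (module +-*-Solver)
open import Data.Sum.Base using (inj₁; inj₂)
open import Function.Base using (_∘_)
open import Function.Bundles using (Func; Equivalence; mk⇔)
open import Level using (0ℓ)
open import Relation.Binary.Bundles using (Poset; Setoid)
open import Relation.Binary.Definitions using (DecidableEquality; Decidable)
open import Relation.Binary.PropositionalEquality
  using (_≡_; _≢_; refl; sym; trans; cong; cong₂; subst; subst₂; isEquivalence)
open import Relation.Nullary.Decidable using (yes; no; map′; _×-dec_)
open import Relation.Nullary.Negation using (¬_; contradiction)

-- Arithmetic of ℝ and ℂ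

pointwise⇒≈ℝ : ∀ {x y} → (∀ n → seq x n ≡ seq y n) → x ≈ℝ y
pointwise⇒≈ℝ {x} {y} x≗y ε 0<ε = 0 , λ n _ →
  subst (λ q → ℚ.∣ q ∣ ℚ.< ε)
    (sym (trans (cong (ℚ._- seq y n) (x≗y n)) (ℚ.+-inverseʳ (seq y n)))) 0<ε

0<½*ε : ∀ {ε} → 0ℚ ℚ.< ε → 0ℚ ℚ.< ½ ℚ.* ε
0<½*ε {ε} 0<ε = subst (ℚ._< ½ ℚ.* ε) (ℚ.*-zeroʳ ½) (ℚ.*-monoʳ-<-pos ½ 0<ε)

½*ε+½*ε≡ε : ∀ ε → ½ ℚ.* ε ℚ.+ ½ ℚ.* ε ≡ ε
½*ε+½*ε≡ε ε = trans (sym (ℚ.*-distribʳ-+ ε ½ ½)) (ℚ.*-identityˡ ε)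

∣p+q∣<ε : ∀ {p q ε} → ℚ.∣ p ∣ ℚ.< ½ ℚ.* ε → ℚ.∣ q ∣ ℚ.< ½ ℚ.* ε → ℚ.∣ p ℚ.+ q ∣ ℚ.< ε
∣p+q∣<ε {p} {q} {ε} ∣p∣< ∣q∣< = subst (ℚ.∣ p ℚ.+ q ∣ ℚ.<_) (½*ε+½*ε≡ε ε)
  (ℚ.≤-<-trans (ℚ.∣p+q∣≤∣p∣+∣q∣ p q) (ℚ.+-mono-< ∣p∣< ∣q∣<))

∣p∣≤∣p+p∣ : ∀ p → ℚ.∣ p ∣ ℚ.≤ ℚ.∣ p ℚ.+ p ∣
∣p∣≤∣p+p∣ p = subst₂ ℚ._≤_ (ℚ.+-identityʳ ℚ.∣ p ∣) ∣p∣+∣p∣≡∣p+p∣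
  (ℚ.+-monoʳ-≤ ℚ.∣ p ∣ (ℚ.0≤∣p∣ p))
  where
  double : ∀ q → q ℚ.+ q ≡ (ℚ.1ℚ ℚ.+ ℚ.1ℚ) ℚ.* q
  double q = sym (trans (ℚ.*-distribʳ-+ q ℚ.1ℚ ℚ.1ℚ)
    (cong₂ ℚ._+_ (ℚ.*-identityˡ q) (ℚ.*-identityˡ q)))

  ∣p∣+∣p∣≡∣p+p∣ : ℚ.∣ p ∣ ℚ.+ ℚ.∣ p ∣ ≡ ℚ.∣ p ℚ.+ p ∣
  ∣p∣+∣p∣≡∣p+p∣ = trans (double ℚ.∣ p ∣)
    (sym (trans (cong ℚ.∣_∣ (double p)) (ℚ.∣p*q∣≡∣p∣*∣q∣ (ℚ.1ℚ ℚ.+ ℚ.1ℚ) p)))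

+ℝ-cong : ∀ {x x′ y y′} → x ≈ℝ x′ → y ≈ℝ y′ → (x +ℝ y) ≈ℝ (x′ +ℝ y′)
+ℝ-cong {x} {x′} {y} {y′} x≈x′ y≈y′ ε 0<ε =
  let M , h = x≈x′ (½ ℚ.* ε) (0<½*ε 0<ε)
      N , k = y≈y′ (½ ℚ.* ε) (0<½*ε 0<ε)
  in M ℕ.⊔ N , λ n M⊔N≤n → subst (λ q → ℚ.∣ q ∣ ℚ.< ε)
       (sym (interchange (seq x n) (seq y n) (seq x′ n) (seq y′ n)))
       (∣p+q∣<ε (h n (ℕ.≤-trans (ℕ.m≤m⊔n M N) M⊔N≤n))
                (k n (ℕ.≤-trans (ℕ.m≤n⊔m M N) M⊔N≤n)))
  where
  interchange : ∀ a b c d →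
    (a ℚ.+ b) ℚ.- (c ℚ.+ d) ≡ (a ℚ.- c) ℚ.+ (b ℚ.- d)
  interchange = solve 4 (λ a b c d →
    (a :+ b) :- (c :+ d) := (a :- c) :+ (b :- d)) refl
    where open +-*-Solver

-- Doubling a rational does not shrink its absolute value, so the index that works for `x +ℝ x` and
-- `ε` works for `x` with the same `ε`.
x+x≈0⇒x≈0 : ∀ {x} → (x +ℝ x) ≈ℝ 0ℝ → x ≈ℝ 0ℝ
x+x≈0⇒x≈0 {x} x+x≈0 ε 0<ε = let N , h = x+x≈0 ε 0<ε in
  N , λ n N≤n → subst (λ q → ℚ.∣ q ∣ ℚ.< ε) (sym (ℚ.+-identityʳ (seq x n)))
    (ℚ.≤-<-trans (∣p∣≤∣p+p∣ (seq x n))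
      (subst (λ q → ℚ.∣ q ∣ ℚ.< ε) (ℚ.+-identityʳ (seq x n ℚ.+ seq x n)) (h n N≤n)))

-- The Cauchy modulus supplies the index, independently of why x is null.
≈0ℝ-stable : ∀ {x} → ¬ ¬ (x ≈ℝ 0ℝ) → x ≈ℝ 0ℝ
≈0ℝ-stable {x} ¬¬x≈0 ε 0<ε with cauchy x (½ ℚ.* ε) (0<½*ε 0<ε)
... | N , h = N , small
  where
  telescope : ∀ a b → (a ℚ.- b) ℚ.+ (b ℚ.- 0ℚ) ≡ a ℚ.- 0ℚ
  telescope = solve 2 (λ a b →
    (a :- b) :+ (b :- con 0ℚ) := a :- con 0ℚ) refl
    where open +-*-Solver

  small : ∀ n → N ≤ n → ℚ.∣ seq x n ℚ.- 0ℚ ∣ ℚ.< ε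
  -- Order on the rationals is decidable, so the double negation is only needed to refute the
  -- negative case.
  small n N≤n with ℚ.∣ seq x n ℚ.- 0ℚ ∣ ℚ.<? ε
  ... | yes p = p
  ... | no ¬p = ⊥-elim (¬¬x≈0 λ x≈0 →
    let M , k = x≈0 (½ ℚ.* ε) (0<½*ε 0<ε)
        m = N ℕ.⊔ M
    in ¬p (subst (λ q → ℚ.∣ q ∣ ℚ.< ε) (telescope (seq x n) (seq x m))
         (∣p+q∣<ε (h n m N≤n (ℕ.m≤m⊔n N M)) (k m (ℕ.m≤n⊔m N M)))))

-- A support is defined by a negation, so lying outside it gives only a doubly negated equation;
-- this recovers the equation.
≈0ℂ-stable : ∀ {w} → ¬ ¬ (w ≈ℂ 0ℂ) → w ≈ℂ 0ℂ
≈0ℂ-stable {w} ¬¬w≈0 =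
  ≈0ℝ-stable {re w} (λ ¬re≈0 → ¬¬w≈0 (¬re≈0 ∘ proj₁)) ,
  ≈0ℝ-stable {im w} (λ ¬im≈0 → ¬¬w≈0 (¬im≈0 ∘ proj₂))

+-0-ℂ-commutativeMonoid : CommutativeMonoid 0ℓ 0ℓ
+-0-ℂ-commutativeMonoid = record
  { Carrier = ℂ
  ; _≈_     = _≈ℂ_
  ; _∙_     = _+ℂ_
  ; ε       = 0ℂ
  ; isCommutativeMonoid = record
    { isMonoid = record
      { isSemigroup = record
        { isMagma = record
          { isEquivalence = Setoid.isEquivalence ℂ-setoid
          ; ∙-cong = λ {w} {w′} {z} {z′} (p , q) (p′ , q′) →
              +ℝ-cong {re w} {re w′} {re z} {re z′} p p′ ,
              +ℝ-cong {im w} {im w′} {im z} {im z′} q q′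
          }
        ; assoc = λ u w z →
            pointwise⇒≈ℝ {re (u +ℂ w +ℂ z)} {re (u +ℂ (w +ℂ z))}
              (λ n → ℚ.+-assoc (seq (re u) n) (seq (re w) n) (seq (re z) n)) ,
            pointwise⇒≈ℝ {im (u +ℂ w +ℂ z)} {im (u +ℂ (w +ℂ z))}
              (λ n → ℚ.+-assoc (seq (im u) n) (seq (im w) n) (seq (im z) n))
        }
      ; identity =
          (λ w →
            pointwise⇒≈ℝ {re (0ℂ +ℂ w)} {re w} (λ n → ℚ.+-identityˡ (seq (re w) n)) ,
            pointwise⇒≈ℝ {im (0ℂ +ℂ w)} {im w} (λ n → ℚ.+-identityˡ (seq (im w) n))) ,
          (λ w →
            pointwise⇒≈ℝ {re (w +ℂ 0ℂ)} {re w} (λ n → ℚ.+-identityʳ (seq (re w) n)) ,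
            pointwise⇒≈ℝ {im (w +ℂ 0ℂ)} {im w} (λ n → ℚ.+-identityʳ (seq (im w) n)))
      }
    ; comm = λ w z →
        pointwise⇒≈ℝ {re (w +ℂ z)} {re (z +ℂ w)}
          (λ n → ℚ.+-comm (seq (re w) n) (seq (re z) n)) ,
        pointwise⇒≈ℝ {im (w +ℂ z)} {im (z +ℂ w)}
          (λ n → ℚ.+-comm (seq (im w) n) (seq (im z) n))
    }
  }

module +ℂ = CommutativeMonoid +-0-ℂ-commutativeMonoid
open CommutativeSemigroupProperties +ℂ.commutativeSemigroup using (interchange)

u≈0∧v≈0⇒u+v≈0 : ∀ {u v} → u ≈ℂ 0ℂ → v ≈ℂ 0ℂ → (u +ℂ v) ≈ℂ 0ℂ
u≈0∧v≈0⇒u+v≈0 {u} {v} u≈0 v≈0 = +ℂ.trans {u +ℂ v} {0ℂ +ℂ 0ℂ} {0ℂ}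
  (+ℂ.∙-cong {u} {0ℂ} {v} {0ℂ} u≈0 v≈0) (+ℂ.identityˡ 0ℂ)

u≈0∧u+v≈0⇒v≈0 : ∀ {u v} → u ≈ℂ 0ℂ → (u +ℂ v) ≈ℂ 0ℂ → v ≈ℂ 0ℂ
u≈0∧u+v≈0⇒v≈0 {u} {v} u≈0 u+v≈0 = begin
  v         ≈⟨ +ℂ.identityˡ v ⟨
  0ℂ +ℂ v   ≈⟨ +ℂ.∙-congʳ {v} {u} {0ℂ} u≈0 ⟨
  u +ℂ v    ≈⟨ u+v≈0 ⟩
  0ℂ        ∎
  where open import Relation.Binary.Reasoning.Setoid ℂ-setoid

v≈0∧u+v≈0⇒u≈0 : ∀ {u v} → v ≈ℂ 0ℂ → (u +ℂ v) ≈ℂ 0ℂ → u ≈ℂ 0ℂ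
v≈0∧u+v≈0⇒u≈0 {u} {v} v≈0 u+v≈0 = u≈0∧u+v≈0⇒v≈0 {v} {u} v≈0
  (+ℂ.trans {v +ℂ u} {u +ℂ v} {0ℂ} (+ℂ.comm v u) u+v≈0)

-- Since (u + v) + (u + w) = 2u + (v + w), the three equations give 2u = 0, and 2 can be cancelled.
pairwiseSums≈0⇒≈0 : ∀ {u v w} → (u +ℂ v) ≈ℂ 0ℂ → (u +ℂ w) ≈ℂ 0ℂ →
                    (v +ℂ w) ≈ℂ 0ℂ → u ≈ℂ 0ℂ
pairwiseSums≈0⇒≈0 {u} {v} {w} u+v≈0 u+w≈0 v+w≈0 =
  x+x≈0⇒x≈0 {re u} (proj₁ u+u≈0) , x+x≈0⇒x≈0 {im u} (proj₂ u+u≈0)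
  where
  u+u≈0 : (u +ℂ u) ≈ℂ 0ℂ
  u+u≈0 = v≈0∧u+v≈0⇒u≈0 {u +ℂ u} {v +ℂ w} v+w≈0
    (+ℂ.trans {(u +ℂ u) +ℂ (v +ℂ w)} {(u +ℂ v) +ℂ (u +ℂ w)} {0ℂ}
      (interchange u u v w) (u≈0∧v≈0⇒u+v≈0 {u +ℂ v} {u +ℂ w} u+v≈0 u+w≈0))

-- The poset

data Tree : Set where
  root  : Tree
  -- join i n lies above the two atoms other than atom i.
  join  : Fin 3 → ℕ → Tree
  child : Tree → ℕ → Tree

data Point : Set where
  atom : Fin 3 → Point
  tree : Tree → Point

atom-injective : ∀ {i j} → atom i ≡ atom j → i ≡ j
atom-injective refl = refl

mutual
  -- Down-sets are explicit lists, so the order is list membership and sums run over the lists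
  -- directly. The clause for `child` makes its strict down-set equal by computation to the down-set
  -- of its parent.
  strictlyBelow : Point → List Point
  strictlyBelow (atom i)          = tree root ∷ []
  strictlyBelow (tree root)       = []
  strictlyBelow (tree (join i n)) =
    tree root ∷ atom (punchIn i zero) ∷ atom (punchIn i (suc zero)) ∷ []
  strictlyBelow (tree (child t n)) = below (tree t)

  below : Point → List Point
  below x = x ∷ strictlyBelow x

infix 4 _⊑_
_⊑_ : Point → Point → Set
x ⊑ y = x ∈ below y

⊑-trans : ∀ {x y z} → x ⊑ y → y ⊑ z → x ⊑ z
⊑-trans x⊑y (here refl) = x⊑y
⊑-trans {z = atom i} (here refl) (there (here refl)) = there (here refl)
⊑-trans {z = tree (join i n)} (here refl) (there (here refl)) = there (here refl)
⊑-trans {z = tree (join i n)} (there ()) (there (here refl))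
⊑-trans {z = tree (join i n)} (here refl) y⊑z@(there (there (here refl))) = y⊑z
⊑-trans {z = tree (join i n)} (there (here refl)) (there (there (here refl))) =
  there (here refl)
⊑-trans {z = tree (join i n)} (here refl) y⊑z@(there (there (there (here refl)))) = y⊑z
⊑-trans {z = tree (join i n)} (there (here refl)) (there (there (there (here refl)))) =
  there (here refl)
⊑-trans {z = tree (child t n)} x⊑y (there y⊑t) = there (⊑-trans x⊑y y⊑t)

root-minimum : ∀ x → tree root ⊑ x
root-minimum (atom i)           = there (here refl)
root-minimum (tree root)        = here refl
root-minimum (tree (join i n))  = there (here refl)
root-minimum (tree (child t n)) = there (root-minimum (tree t))

-- The height of a point, that is, the number of steps in a longest chain up to it. Its strict
-- growth gives antisymmetry and rules out repetitions in `below`.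
rank : Point → ℕ
rank (atom i)           = 1
rank (tree root)        = 0
rank (tree (join i n))  = 2
rank (tree (child t n)) = ℕ.suc (rank (tree t))

strictlyBelow⇒rank< : ∀ {x} y → x ∈ strictlyBelow y → rank x ℕ.< rank y
strictlyBelow⇒rank< (atom i)           (here refl)                 = s≤s z≤n
strictlyBelow⇒rank< (tree (join i n))  (here refl)                 = s≤s z≤n
strictlyBelow⇒rank< (tree (join i n))  (there (here refl))         = s≤s (s≤s z≤n)
strictlyBelow⇒rank< (tree (join i n))  (there (there (here refl))) = s≤s (s≤s z≤n)
strictlyBelow⇒rank< (tree (child t n)) (here refl)                 = ℕ.≤-refl
strictlyBelow⇒rank< (tree (child t n)) (there x⊏t)                 =
  ℕ.m≤n⇒m≤1+n (strictlyBelow⇒rank< (tree t) x⊏t)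

⊑⇒rank≤ : ∀ {x y} → x ⊑ y → rank x ≤ rank y
⊑⇒rank≤ (here refl) = ℕ.≤-refl
⊑⇒rank≤ {y = y} (there x⊏y) = ℕ.<⇒≤ (strictlyBelow⇒rank< y x⊏y)

⊑-antisym : ∀ {x y} → x ⊑ y → y ⊑ x → x ≡ y
⊑-antisym (here x≡y) _ = x≡y
⊑-antisym {y = y} (there x⊏y) y⊑x =
  contradiction (⊑⇒rank≤ y⊑x) (ℕ.<⇒≱ (strictlyBelow⇒rank< y x⊏y))

below-unique : ∀ x → Unique (below x)
below-unique x = ¬Any⇒All¬ _ x∉strictlyBelow ∷ strictlyBelow-unique x
  where
  x∉strictlyBelow : x ∉ strictlyBelow x
  x∉strictlyBelow x⊏x = ℕ.<-irrefl refl (strictlyBelow⇒rank< x x⊏x)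

  strictlyBelow-unique : ∀ x → Unique (strictlyBelow x)
  strictlyBelow-unique (atom i)           = [] ∷ []
  strictlyBelow-unique (tree root)        = []
  strictlyBelow-unique (tree (join i n))  =
    ((λ ()) ∷ (λ ()) ∷ []) ∷ (punchIn-zero≢one ∷ []) ∷ [] ∷ []
    where
    punchIn-zero≢one : atom (punchIn i zero) ≢ atom (punchIn i (suc zero))
    punchIn-zero≢one eq with Fin.punchIn-injective i zero (suc zero) (atom-injective eq)
    ... | ()
  strictlyBelow-unique (tree (child t n)) = below-unique (tree t)

infix 4 _≟ᵗ_ _≟_
_≟ᵗ_ : DecidableEquality Tree
root      ≟ᵗ root      = yes refl
root      ≟ᵗ join _ _  = no λ ()
root      ≟ᵗ child _ _ = no λ ()
join _ _  ≟ᵗ root      = no λ ()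
join i m  ≟ᵗ join j n  = map′ (λ { (refl , refl) → refl }) (λ { refl → refl , refl })
                           (i Fin.≟ j ×-dec m ℕ.≟ n)
join _ _  ≟ᵗ child _ _ = no λ ()
child _ _ ≟ᵗ root      = no λ ()
child _ _ ≟ᵗ join _ _  = no λ ()
child s m ≟ᵗ child t n = map′ (λ { (refl , refl) → refl }) (λ { refl → refl , refl })
                           (s ≟ᵗ t ×-dec m ℕ.≟ n)

_≟_ : DecidableEquality Point
atom i ≟ atom j = map′ (cong atom) (λ { refl → refl }) (i Fin.≟ j)
atom _ ≟ tree _ = no λ ()
tree _ ≟ atom _ = no λ ()
tree s ≟ tree t = map′ (cong tree) (λ { refl → refl }) (s ≟ᵗ t)

open import Data.List.Membership.DecPropositional _≟_ using (_∈?_)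

_⊑?_ : Decidable _⊑_
x ⊑? y = x ∈? below y

Q-poset : Poset 0ℓ 0ℓ 0ℓ
Q-poset = record
  { Carrier = Point
  ; _≈_     = _≡_
  ; _≤_     = _⊑_
  ; isPartialOrder = record
    { isPreorder = record
      { isEquivalence = isEquivalence
      ; reflexive     = here
      ; trans         = ⊑-trans
      }
    ; antisym = ⊑-antisym
    }
  }

Q : LocallyFinitePosetWithMin
Q = record
  { poset         = Q-poset
  ; locallyFinite = λ x y → record
    { elements = filter (x ⊑?_) (below y)
    ; unique   = Unique.filter⁺ (x ⊑?_) (below-unique y)
    ; exact    = λ z → mk⇔
        (λ z∈ → let z⊑y , x⊑z = ∈-filter⁻ (x ⊑?_) z∈ in x⊑z , z⊑y)
        (λ (x⊑z , z⊑y) → ∈-filter⁺ (x ⊑?_) z⊑y x⊑z)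
    }
  ; ⊥       = tree root
  ; minimum = root-minimum
  }

-- The Möbius uncertainty property

sumOver : List Point → (Point → ℂ) → ℂ
sumOver xs f = foldr _+ℂ_ 0ℂ (map f xs)

-- The interval from the minimum to `z` is obtained by filtering `below z`, and the filter keeps
-- every entry because `tree root` lies below everything.
sumBelow≡sumOver-below : ∀ f z →
  LocallyFinitePosetWithMin.sumBelow Q f z ≡ sumOver (below z) f
sumBelow≡sumOver-below f z = cong (λ xs → sumOver xs f)
  (filter-all (tree root ⊑?_) (All.tabulate {xs = below z} (λ {x} _ → root-minimum x)))

-- The label of a point within its infinite family of siblings, with default 0 for the root and the
-- atoms.
index : Point → ℕ
index (atom i)           = 0
index (tree root)        = 0
index (tree (join i n))  = n
index (tree (child t n)) = n

-- A label larger than every index occurring in `xs` cannot belong to an entry of `xs`.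
fresh : (h : ℕ → Point) → (∀ n → index (h n) ≡ n) →
        ∀ xs → ∃[ n ] h n ∉ xs
fresh h index-h xs = n , λ hn∈xs → ℕ.<-irrefl refl
  (subst (ℕ._< n) (index-h n)
    (s≤s (All.lookup (xs≤max 0 (map index xs)) (∈-map⁺ index hn∈xs))))
  where
  n = ℕ.suc (max 0 (map index xs))

-- The list `xs` stands for the union of the two supports, and `sum-vanishes` says that the summed
-- function is zero outside it.
module _ (f : Point → ℂ) (xs : List Point)
  (f-vanishes : ∀ {x} → x ∉ xs → f x ≈ℂ 0ℂ)
  (sum-vanishes : ∀ {x} → x ∉ xs → sumOver (below x) f ≈ℂ 0ℂ)
  where

  strictSum-vanishes : ∀ {x} → x ∉ xs → sumOver (strictlyBelow x) f ≈ℂ 0ℂ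
  strictSum-vanishes {x} x∉xs = u≈0∧u+v≈0⇒v≈0 {f x}
    {sumOver (strictlyBelow x) f} (f-vanishes x∉xs) (sum-vanishes x∉xs)

  -- The strict sum at a fresh child of `t` is exactly this sum. Atoms have no children, so they are
  -- treated separately through the joins.
  treeSum≈0 : ∀ t → sumOver (below (tree t)) f ≈ℂ 0ℂ
  treeSum≈0 t = strictSum-vanishes
    (proj₂ (fresh (λ n → tree (child t n)) (λ _ → refl) xs))

  f-root≈0 : f (tree root) ≈ℂ 0ℂ
  f-root≈0 = v≈0∧u+v≈0⇒u≈0 {f (tree root)} {0ℂ} (+ℂ.refl {0ℂ}) (treeSum≈0 root)

  atomPair≈0 : ∀ i → (f (atom (punchIn i zero)) +ℂ f (atom (punchIn i (suc zero)))) ≈ℂ 0ℂ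
  atomPair≈0 i = +ℂ.trans {u +ℂ v} {u +ℂ (v +ℂ 0ℂ)} {0ℂ}
    (+ℂ.∙-congˡ {u} {v} {v +ℂ 0ℂ} (+ℂ.sym {v +ℂ 0ℂ} {v} (+ℂ.identityʳ v)))
    -- The strict down-set of a fresh join consists of the root and the two atoms; removing the zero
    -- value at the root leaves their sum.
    (u≈0∧u+v≈0⇒v≈0 {f (tree root)} {u +ℂ (v +ℂ 0ℂ)} f-root≈0
      (strictSum-vanishes (proj₂ (fresh (λ n → tree (join i n)) (λ _ → refl) xs))))
    where
    u = f (atom (punchIn i zero))
    v = f (atom (punchIn i (suc zero)))

  f-atom≈0 : ∀ i → f (atom i) ≈ℂ 0ℂ
  f-atom≈0 zero = pairwiseSums≈0⇒≈0 {a₀} {a₁} {a₂}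
    -- Each index names the omitted atom: leaving out 2, 1 and 0 gives the pairs (0,1), (0,2) and
    -- (1,2).
    (atomPair≈0 (suc (suc zero))) (atomPair≈0 (suc zero)) (atomPair≈0 zero)
    where a₀ = f (atom zero); a₁ = f (atom (suc zero)); a₂ = f (atom (suc (suc zero)))
  f-atom≈0 (suc zero) = u≈0∧u+v≈0⇒v≈0 {f (atom zero)} {f (atom (suc zero))}
    (f-atom≈0 zero) (atomPair≈0 (suc (suc zero)))
  f-atom≈0 (suc (suc zero)) = u≈0∧u+v≈0⇒v≈0 {f (atom zero)} {f (atom (suc (suc zero)))}
    (f-atom≈0 zero) (atomPair≈0 (suc zero))

  -- No induction on `t` is required: below a join only the root and atoms occur, and for a child
  -- the sum is the full sum at its parent. Subtracting it from the full sum at `t` isolates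
  -- `f (tree t)`.
  strictTreeSum≈0 : ∀ t → sumOver (strictlyBelow (tree t)) f ≈ℂ 0ℂ
  strictTreeSum≈0 root        = +ℂ.refl {0ℂ}
  strictTreeSum≈0 (join i n)  = u≈0∧v≈0⇒u+v≈0 {f (tree root)} {u +ℂ (v +ℂ 0ℂ)} f-root≈0
    (u≈0∧v≈0⇒u+v≈0 {u} {v +ℂ 0ℂ} (f-atom≈0 (punchIn i zero))
      (u≈0∧v≈0⇒u+v≈0 {v} {0ℂ} (f-atom≈0 (punchIn i (suc zero))) (+ℂ.refl {0ℂ})))
    where
    u = f (atom (punchIn i zero))
    v = f (atom (punchIn i (suc zero)))
  strictTreeSum≈0 (child t n) = treeSum≈0 t

  f≈0 : ∀ x → f x ≈ℂ 0ℂ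
  f≈0 (atom i) = f-atom≈0 i
  f≈0 (tree t) = v≈0∧u+v≈0⇒u≈0 {f (tree t)} {sumOver (strictlyBelow (tree t)) f}
    (strictTreeSum≈0 t) (treeSum≈0 t)

Q-möbiusUncertainty : MöbiusUncertainty Q
Q-möbiusUncertainty f g f≢0 _ g≈sum ¬infinite =
  -- The goal is absurdity and infinite means not finite, so both supports may be assumed to be
  -- listed.
  ¬infinite (inj₁ λ F → ¬infinite (inj₂ λ G → f≢0 (vanishes F G)))
  where
  open LocallyFinitePosetWithMin Q using (module Eq; sumBelow)
  open Finite using (elements; exact)

  ≈0-outside : ∀ h (H : Finite Eq.setoid (support Q h)) {x} →
               x ∉ elements H → Func.to h x ≈ℂ 0ℂ
  ≈0-outside h H {x} x∉H = ≈0ℂ-stable {Func.to h x} (x∉H ∘ Equivalence.from (exact H x))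

  vanishes : Finite Eq.setoid (support Q f) → Finite Eq.setoid (support Q g) →
             IdenticallyZero Q f
  vanishes F G = f≈0 (Func.to f) (elements F ++ elements G)
    (λ x∉ → ≈0-outside f F (x∉ ∘ ∈-++⁺ˡ))
    (λ {x} x∉ → subst (_≈ℂ 0ℂ) (sumBelow≡sumOver-below (Func.to f) x)
      (+ℂ.trans {sumBelow (Func.to f) x} {Func.to g x} {0ℂ}
        (+ℂ.sym {Func.to g x} {sumBelow (Func.to f) x} (g≈sum x))
        (≈0-outside g G (x∉ ∘ ∈-++⁺ʳ (elements F)))))

-- Failure of H₃

RefutingSubset⇒¬PropertyH : ∀ P {k} → RefutingSubset P k → ¬ PropertyH P k
RefutingSubset⇒¬PropertyH P (S , finite) H =
  let z , z∈S , infinite = H S in infinite (finite z z∈S)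

-- Atoms enter the down-set of a tree point only through a join, which brings two of them; children
-- inherit both from their parent.
secondAtom : ∀ {i} t → atom i ⊑ tree t → ∃[ j ] (j ≢ i × atom j ⊑ tree t)
secondAtom (join k n) (there (there (here refl))) =
  punchIn k (suc zero) ,
  (λ eq → contradiction (Fin.punchIn-injective k (suc zero) zero eq) λ ()) ,
  there (there (there (here refl)))
secondAtom (join k n) (there (there (there (here refl)))) =
  punchIn k zero ,
  (λ eq → contradiction (Fin.punchIn-injective k zero (suc zero) eq) λ ()) ,
  there (there (here refl))
secondAtom (child t n) (there i⊑t) =
  let j , j≢i , j⊑t = secondAtom t i⊑t in j , j≢i , there j⊑t

atom⊑atom⇒≡ : ∀ {i j} → atom i ⊑ atom j → i ≡ j
atom⊑atom⇒≡ (here refl) = refl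
atom⊑atom⇒≡ (there (here ()))

atoms : SubsetOfSize (Poset.Eq.setoid Q-poset) 3
atoms = record
  { elements = map atom (allFin 3)
  ; unique   = Unique.map⁺ atom-injective (Unique.allFin⁺ 3)
  ; size     = refl
  }

-- Distinct atoms are incomparable, and a tree point above `atom i` is excluded by the second atom
-- below it.
aboveOnlyAtom⇒≡ : ∀ i x → AboveOnly Q-poset atoms (atom i) x → x ≡ atom i
aboveOnlyAtom⇒≡ i (atom j) (i⊑j , _) = cong atom (sym (atom⊑atom⇒≡ i⊑j))
aboveOnlyAtom⇒≡ i (tree t) (i⊑t , onlyAbove) =
  let j , j≢i , j⊑t = secondAtom t i⊑t in
  contradiction j⊑t
    (onlyAbove (atom j) (∈-map⁺ atom (∈-allFin j)) (j≢i ∘ atom-injective))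

atom-aboveOnly : ∀ i → AboveOnly Q-poset atoms (atom i) (atom i)
atom-aboveOnly i = here refl , λ y y∈atoms y≢i y⊑i →
  let j , _ , y≡j = ∈-map⁻ atom y∈atoms in
  y≢i (trans y≡j (cong atom (atom⊑atom⇒≡ (subst (_⊑ atom i) y≡j y⊑i))))

atoms-refute : RefutingSubset Q-poset 3
atoms-refute = atoms , λ z z∈atoms → let i , _ , z≡i = ∈-map⁻ atom z∈atoms in
  subst (Finite (Poset.Eq.setoid Q-poset) ∘ AboveOnly Q-poset atoms) (sym z≡i) (record
    { elements = atom i ∷ []
    ; unique   = [] ∷ []
    ; exact    = λ x → mk⇔
        (λ { (here refl) → atom-aboveOnly i })
        (here ∘ aboveOnlyAtom⇒≡ i x)
    })

Q-¬H₃ : ¬ PropertyH Q-poset 3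
Q-¬H₃ = RefutingSubset⇒¬PropertyH Q-poset atoms-refute

theorem1p7 : (Σ[ Q ∈ LocallyFinitePosetWithMin ]
    (MöbiusUncertainty Q
    × ¬ PropertyH (poset Q) 3
    × RefutingSubset (poset Q) 3))
    × ¬ ((Q : LocallyFinitePosetWithMin) → MöbiusUncertainty Q →
    (k : ℕ) → 1 ≤ k → PropertyH (poset Q) k)
theorem1p7 =
  (Q , Q-möbiusUncertainty , Q-¬H₃ , atoms-refute) ,
  λ uncertainty⇒H → Q-¬H₃ (uncertainty⇒H Q Q-möbiusUncertainty 3 (s≤s z≤n))
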